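{- There is an $n$-uniform cross-intersecting family $H$ with $Q(H) = \{0, 1, 2, n-1\}$ and $\chi(H) = 3$.
   Context: A hypergraph is a pair $(V,E)$ where $V$ is a set of vertices and $E$ is a set of subsets of $V$ (edges); it is $n$-uniform if every edge has exactly $n$ vertices. A cross-intersecting family $H = (V, A, B)$ is a hypergraph with vertex set $V$ and edge set $E = A \cup B$ such that every $a \in A$ intersects every $b \in B$, and $A$, $B$ are not empty. The set of the sizes of pairwise edge intersections is $Q(H) := \{|e_1 \cap e_2| : e_1, e_2 \in E,\ e_1 \neq e_2\}$. A coloring of the vertices is proper if there are no monochromatic edges; the chromatic number $\chi(H)$ is the minimal number of colors that admits a proper coloring. -}

module Defs where

open import Level using (0ℓ)
open import Data.Nat using (ℕ; _≤_)
open import Data.Fin using (Fin)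
open import Data.Fin.Subset using (Subset; _∩_; ∣_∣; Nonempty) renaming (_∈_ to _∈ₛ_)
open import Data.Product using (∃; ∃-syntax; _×_)
open import Relation.Nullary using (¬_)
open import Relation.Unary using (Pred; _∈_; _∪_; Satisfiable)
open import Relation.Binary.PropositionalEquality using (_≡_; _≢_)

-- Hypergraphs are finite: the vertex set is Fin order, and E is a set
-- (predicate), so edges have no multiplicities.
record Hypergraph : Set₁ where
  field
    order : ℕ
    E     : Pred (Subset order) 0ℓ

module _ (H : Hypergraph) where
  open Hypergraph H

  Uniform : ℕ → Set
  Uniform n = ∀ e → e ∈ E → ∣ e ∣ ≡ n

  Q : Pred ℕ 0ℓ
  Q k = ∃[ e₁ ] ∃[ e₂ ] (e₁ ∈ E × e₂ ∈ E × e₁ ≢ e₂ × ∣ e₁ ∩ e₂ ∣ ≡ k)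

  Monochromatic : ∀ {k} → (Fin order → Fin k) → Subset order → Set
  Monochromatic c e = ∀ u v → u ∈ₛ e → v ∈ₛ e → c u ≡ c v

  Proper : ∀ {k} → (Fin order → Fin k) → Set
  Proper c = ∀ e → e ∈ E → ¬ Monochromatic c e

  Colorable : ℕ → Set
  Colorable k = ∃ λ (c : Fin order → Fin k) → Proper c

  IsChromaticNumber : ℕ → Set
  IsChromaticNumber k = Colorable k × (∀ j → Colorable j → k ≤ j)

record CrossIntersectingFamily : Set₁ where
  field
    order      : ℕ
    A B        : Pred (Subset order) 0ℓ
    A-nonempty : Satisfiable A
    B-nonempty : Satisfiable B
    cross      : ∀ a b → a ∈ A → b ∈ B → Nonempty (a ∩ b)

  hypergraph : Hypergraph
  hypergraph = record { order = order ; E = A ∪ B }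

{-# OPTIONS --safe #-}
-- Let G be a linear (n-1)-uniform hypergraph with chromatic number 3, and X a
-- set of n new points.  Take A = {S ∪ {x} : S ∈ G, x ∈ X} and B = {X}.  If X
-- and all S ∪ {x} are bichromatic in a 2-colouring, then so is every S, which
-- is impossible.  One more edge, through two points of X, fixes Q.
--
-- For G with m-sets as edges, take the L² lines y = a x + b with a, b < L over
-- 2m abscissas.  In a 2-colouring every line contains a monochromatic m-set,
-- so choosing an m-set on each line greedily leaves at each step at most the
-- fraction 1 - 1/2^(2m) of the colourings not yet excluded.  The lines number
-- L² but their points only O(L), so for large L no 2-colouring survives.  A
-- critical subfamily has chromatic number exactly 3.
module Submission where

open import Data.Bool as Bool using (true; false; if_then_else_)
open import Data.Fin using (Fin; zero; suc; toℕ; fromℕ<; splitAt; combine; quotient; remainder; inject₁; inject≤; _↑ˡ_; _↑ʳ_; finToFun; funToFin)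
open import Data.Fin.Properties as Fin using (toℕ<n; toℕ-fromℕ<; toℕ-injective; inject≤-injective; inject₁-injective; combine-injective; combine-remQuot; splitAt-↑ˡ; splitAt-↑ʳ; finToFun-funToFin)
open import Data.Fin.Subset using (Subset; _∩_; ∣_∣; Nonempty; ⁅_⁆; ⊥; ⊤; inside) renaming (_∈_ to _∈ₛ_; _∉_ to _∉ₛ_)
open import Data.Fin.Subset.Properties using (_∈?_; nonempty?; Empty-unique; ∉⊥; ∣⊥∣≡0; ∣⊤∣≡n; x∈⁅x⁆; x∈⁅y⁆⇒x≡y; ∣⁅x⁆∣≡1; p⊆q⇒∣p∣≤∣q∣; x∈p∩q⁻; ∩-comm; ∩-idem; ∩-zeroˡ; ∩-zeroʳ; ∩-identityʳ; ∣p∩q∣≤∣p∣)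
open import Data.List using (List; []; _∷_; length; filter; allFin)
open import Data.List.Membership.Propositional as List using ()
open import Data.List.Membership.Propositional.Properties using (∈-filter⁺; ∈-filter⁻; ∈-allFin)
open import Data.List.Properties using (filter-all; length-tabulate)
open import Data.List.Relation.Unary.All as All using ()
open import Data.Nat using (ℕ; zero; suc; _+_; _*_; _^_; _∸_; _≤_; _<_; z≤n; s≤s; s≤s⁻¹)
open import Data.Nat.Properties as ℕ
open import Data.Nat.Tactic.RingSolver using (solve-∀)
open import Data.Product using (∃; _×_; _,_; proj₁; proj₂)
open import Data.Sum using (_⊎_; inj₁; inj₂; [_,_]′)
open import Data.Vec using ([]; _∷_; _++_; here; there)
open import Data.Vec.Properties using (≡-dec)
open import Function using (_∘_; const)
open import Relation.Binary.Definitions using (tri<; tri≈; tri>)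
open import Relation.Binary.PropositionalEquality using (_≡_; _≢_; refl; sym; trans; cong; cong₂; subst; subst₂; subst-subst-sym)
open import Relation.Nullary using (¬_; Dec; yes; no; contradiction; ¬?)
open import Relation.Nullary.Decidable using (_→-dec_; _×-dec_)
open import Relation.Unary using (Pred; Decidable; Satisfiable; _⊆_; _≐_; _∪_; ｛_｝)
open import Level using (0ℓ)
open import Defs

private
  variable
    m n k : ℕ

-- Sets constant under a colouring; sizes and concatenations of subsets

ConstantOn : (Fin n → Fin k) → Subset n → Set
ConstantOn c s = ∀ u v → u ∈ₛ s → v ∈ₛ s → c u ≡ c v

constantOn? : (c : Fin n → Fin k) (s : Subset n) → Dec (ConstantOn c s)
constantOn? c s = Fin.all? λ u → Fin.all? λ v →
  (u ∈? s) →-dec ((v ∈? s) →-dec (c u Fin.≟ c v))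

-- Needed because `finToFun (funToFin c)` agrees with `c` only pointwise, and every exhaustive
-- search over colourings runs over their codes.
constantOn-cong : {c c′ : Fin n → Fin k} {s : Subset n} → (∀ u → c u ≡ c′ u) → ConstantOn c s → ConstantOn c′ s
constantOn-cong eq con u v u∈ v∈ = trans (sym (eq u)) (trans (con u v u∈ v∈) (eq v))

subsingleton⇒∣p∣≤1 : (p : Subset n) → (∀ u v → u ∈ₛ p → v ∈ₛ p → u ≡ v) → ∣ p ∣ ≤ 1
subsingleton⇒∣p∣≤1 {n} p sub with nonempty? p
... | no empty rewrite Empty-unique empty = subst (_≤ 1) (sym (∣⊥∣≡0 n)) z≤n
... | yes (x , x∈p) = subst (∣ p ∣ ≤_) (∣⁅x⁆∣≡1 x)
  (p⊆q⇒∣p∣≤∣q∣ λ {y} y∈p → subst (_∈ₛ ⁅ x ⁆) (sub x y x∈p y∈p) (x∈⁅x⁆ x))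

positive⇒nonempty : (p : Subset n) → 1 ≤ ∣ p ∣ → Nonempty p
positive⇒nonempty {n} p 1≤p with nonempty? p
... | yes x∈p = x∈p
... | no empty rewrite Empty-unique empty = contradiction (subst (1 ≤_) (∣⊥∣≡0 n) 1≤p) λ ()

other-member : (p : Subset n) → 2 ≤ ∣ p ∣ → ∀ v → ∃ λ w → w ∈ₛ p × w ≢ v
other-member p 2≤p v with Fin.any? (λ w → (w ∈? p) ×-dec ¬? (w Fin.≟ v))
... | yes found = found
... | no none = contradiction
  (≤-trans 2≤p (subsingleton⇒∣p∣≤1 p λ u w u∈p w∈p → trans (only u u∈p) (sym (only w w∈p))))
  λ { (s≤s ()) }
  where
  only : ∀ w → w ∈ₛ p → w ≡ v
  only w w∈p with w Fin.≟ v
  ... | yes w≡v = w≡v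
  ... | no w≢v = contradiction (w , w∈p , w≢v) none

∣++∣ : (p : Subset m) (q : Subset n) → ∣ p ++ q ∣ ≡ ∣ p ∣ + ∣ q ∣
∣++∣ [] q = refl
∣++∣ (true ∷ p) q = cong suc (∣++∣ p q)
∣++∣ (false ∷ p) q = ∣++∣ p q

∩-++ : (p p′ : Subset m) {q q′ : Subset n} → (p ++ q) ∩ (p′ ++ q′) ≡ (p ∩ p′) ++ (q ∩ q′)
∩-++ [] [] = refl
∩-++ (x ∷ p) (y ∷ p′) = cong (_ ∷_) (∩-++ p p′)

∣++-∩-++∣ : (p p′ : Subset m) {q q′ : Subset n} → ∣ (p ++ q) ∩ (p′ ++ q′) ∣ ≡ ∣ p ∩ p′ ∣ + ∣ q ∩ q′ ∣
∣++-∩-++∣ p p′ {q} {q′} = trans (cong ∣_∣ (∩-++ p p′)) (∣++∣ (p ∩ p′) (q ∩ q′))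

∈-++⁺ˡ : {p : Subset m} {q : Subset n} {u : Fin m} → u ∈ₛ p → u ↑ˡ n ∈ₛ p ++ q
∈-++⁺ˡ here = here
∈-++⁺ˡ (there u∈p) = there (∈-++⁺ˡ u∈p)

∈-++⁺ʳ : (p : Subset m) {q : Subset n} {u : Fin n} → u ∈ₛ q → m ↑ʳ u ∈ₛ p ++ q
∈-++⁺ʳ [] u∈q = u∈q
∈-++⁺ʳ (_ ∷ p) u∈q = there (∈-++⁺ʳ p u∈q)

∈-++⁻ : (p : Subset m) {q : Subset n} {v : Fin (m + n)} → v ∈ₛ p ++ q →
  (∃ λ u → u ∈ₛ p × v ≡ u ↑ˡ n) ⊎ (∃ λ u → u ∈ₛ q × v ≡ m ↑ʳ u)
∈-++⁻ [] v∈q = inj₂ (_ , v∈q , refl)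
∈-++⁻ (_ ∷ p) here = inj₁ (zero , here , refl)
∈-++⁻ (_ ∷ p) (there v∈) with ∈-++⁻ p v∈
... | inj₁ (u , u∈p , refl) = inj₁ (suc u , there u∈p , refl)
... | inj₂ (u , u∈q , refl) = inj₂ (u , u∈q , refl)

-- Greedy covering

length-filter-split : ∀ {C : Set} {P : Pred C 0ℓ} (P? : Decidable P) xs →
  length xs ≡ length (filter P? xs) + length (filter (¬? ∘ P?) xs)
length-filter-split P? [] = refl
length-filter-split P? (x ∷ xs) with P? x
... | yes _ = cong suc (length-filter-split P? xs)
... | no _ = trans (cong suc (length-filter-split P? xs)) (sym (+-suc _ _))

-- Induction on the number of classes: what lies outside class `zero` is shared among the remaining
-- classes, and the larger of class `zero` and the best remaining one serves. The classes may
-- overlap.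
pigeonhole : ∀ {C : Set} D (R : Fin (suc D) → C → Set) (R? : ∀ d → Decidable (R d)) (xs : List C) →
  (∀ {x} → x List.∈ xs → ∃ λ d → R d x) → ∃ λ d → length xs ≤ suc D * length (filter (R? d) xs)
pigeonhole zero R R? xs total = zero , ≤-reflexive
  (trans (sym (cong length (filter-all (R? zero) (All.tabulate λ x∈xs → R0 (total x∈xs))))) (sym (+-identityʳ _)))
  where
  R0 : ∀ {x} → (∃ λ d → R d x) → R zero x
  R0 (zero , Rx) = Rx
pigeonhole (suc D) R R? xs total with pigeonhole D (R ∘ suc) (R? ∘ suc) ys total′
  where
  ys = filter (¬? ∘ R? zero) xs
  total′ : ∀ {x} → x List.∈ ys → ∃ λ d → R (suc d) x
  total′ x∈ys with ∈-filter⁻ (¬? ∘ R? zero) {xs = xs} x∈ys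
  ... | x∈xs , ¬R0x with total x∈xs
  ... | zero , R0x = contradiction R0x ¬R0x
  ... | suc d , Rdx = d , Rdx
... | d , IH = choose (≤-total k₀ k₁)
  where
  k₀ = length (filter (R? zero) xs)
  k₁ = length (filter (R? (suc d)) xs)
  -- The induction hypothesis counts class `suc d` only outside class `zero`; over all of `xs` the
  -- count can only grow.
  count-mono : ∀ zs → length (filter (R? (suc d)) (filter (¬? ∘ R? zero) zs)) ≤ length (filter (R? (suc d)) zs)
  count-mono [] = z≤n
  count-mono (z ∷ zs) with R? zero z
  count-mono (z ∷ zs) | yes _ with R? (suc d) z
  ... | yes _ = m≤n⇒m≤1+n (count-mono zs)
  ... | no _ = count-mono zs
  count-mono (z ∷ zs) | no _ with R? (suc d) z
  ... | yes _ = s≤s (count-mono zs)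
  ... | no _ = count-mono zs
  bound : length xs ≤ k₀ + suc D * k₁
  bound = ≤-trans (≤-reflexive (length-filter-split (R? zero) xs))
    (+-monoʳ-≤ k₀ (≤-trans IH (*-monoʳ-≤ (suc D) (count-mono xs))))
  choose : k₀ ≤ k₁ ⊎ k₁ ≤ k₀ → ∃ λ e → length xs ≤ suc (suc D) * length (filter (R? e) xs)
  choose (inj₁ k₀≤k₁) = suc d , ≤-trans bound (+-monoˡ-≤ (suc D * k₁) k₀≤k₁)
  choose (inj₂ k₁≤k₀) = zero , ≤-trans bound (+-monoʳ-≤ k₀ (*-monoʳ-≤ (suc D) k₁≤k₀))

-- Some choice at each i handles a fraction 1/(q+1) of what is left.
greedy-cover : ∀ {C : Set} q K (R : Fin K → Fin (suc q) → C → Set) (R? : ∀ i d → Decidable (R i d)) →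
  (∀ i x → ∃ λ d → R i d x) → (xs : List C) → length xs * q ^ K < suc q ^ K →
  ∃ λ (σ : Fin K → Fin (suc q)) → ∀ {x} → x List.∈ xs → ∃ λ i → R i (σ i) x
-- With no steps left, `small` says that the length is below 1, so nothing remains to be covered.
greedy-cover q zero R R? total [] small = (λ ()) , λ ()
greedy-cover q zero R R? total (x ∷ xs) (s≤s ())
greedy-cover {C} q (suc K) R R? total xs small = extend (pigeonhole q (R zero) (R? zero) xs λ {x} _ → total zero x)
  where
  extend : (∃ λ d → length xs ≤ suc q * length (filter (R? zero d) xs)) →
    ∃ λ (σ : Fin (suc K) → Fin (suc q)) → ∀ {x} → x List.∈ xs → ∃ λ i → R i (σ i) x
  extend (d , many) = σ , covered
    where
    ys = filter (¬? ∘ R? zero d) xs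
    h = length (filter (R? zero d) xs)
    l = length ys
    split : length xs ≡ h + l
    split = length-filter-split (R? zero d) xs
    l≤qh : l ≤ q * h
    l≤qh = +-cancelˡ-≤ h l (q * h) (subst (_≤ h + q * h) split many)
    -- The uncovered part is at most the fraction `q / suc q` of `xs`. This pays for one factor on
    -- each side of `small`.
    shrink : suc q * l ≤ q * length xs
    shrink = begin
      l + q * l       ≤⟨ +-monoˡ-≤ (q * l) l≤qh ⟩
      q * h + q * l   ≡⟨ *-distribˡ-+ q h l ⟨
      q * (h + l)     ≡⟨ cong (q *_) split ⟨
      q * length xs   ∎
      where open ≤-Reasoning
    small′ : l * q ^ K < suc q ^ K
    small′ = *-cancelˡ-< (suc q) (l * q ^ K) (suc q ^ K) (begin-strict
      suc q * (l * q ^ K)       ≡⟨ *-assoc (suc q) l (q ^ K) ⟨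
      suc q * l * q ^ K         ≤⟨ *-monoˡ-≤ (q ^ K) shrink ⟩
      q * length xs * q ^ K     ≡⟨ cong (_* q ^ K) (*-comm q (length xs)) ⟩
      length xs * q * q ^ K     ≡⟨ *-assoc (length xs) q (q ^ K) ⟩
      length xs * (q * q ^ K)   <⟨ small ⟩
      suc q * suc q ^ K         ∎)
      where open ≤-Reasoning
    rest = greedy-cover q K (R ∘ suc) (R? ∘ suc) (total ∘ suc) ys small′
    σ : Fin (suc K) → Fin (suc q)
    σ zero = d
    σ (suc i) = proj₁ rest i
    covered : ∀ {x} → x List.∈ xs → ∃ λ i → R i (σ i) x
    covered {x} x∈xs with R? zero d x
    ... | yes Rx = zero , Rx
    ... | no ¬Rx with proj₂ rest (∈-filter⁺ (¬? ∘ R? zero d) x∈xs ¬Rx)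
    ... | i , Rix = suc i , Rix

-- Bernoulli's inequality and the counting estimate

bernoulli : ∀ q n → q ^ suc n + suc n * q ^ n ≤ suc q ^ suc n
bernoulli q zero = ≤-reflexive (lemma q)
  where
  lemma : ∀ q → q * 1 + (1 + 0) ≡ (1 + q) * 1
  lemma = solve-∀
bernoulli q (suc n) = begin
  -- The induction hypothesis multiplied by `suc q` exceeds what is needed by exactly `suc n * a`.
  q * (q * a) + suc (suc n) * (q * a)               ≤⟨ m≤m+n _ (suc n * a) ⟩
  q * (q * a) + suc (suc n) * (q * a) + suc n * a   ≡⟨ lemma q n a ⟩
  suc q * (q * a + suc n * a)                       ≤⟨ *-monoʳ-≤ (suc q) (bernoulli q n) ⟩
  suc q * suc q ^ suc n                             ∎
  where
  open ≤-Reasoning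
  a = q ^ n
  lemma : ∀ q n a → q * (q * a) + (2 + n) * (q * a) + (1 + n) * a ≡ (1 + q) * (q * a + (1 + n) * a)
  lemma = solve-∀

-- This is `(1 + 1/q) ^ (q + 1) ≥ 2` cleared of denominators, so that `q = 0` is covered as well.
doubling : ∀ q → 2 * q ^ suc q ≤ suc q ^ suc q
doubling q = begin
  2 * (q * q ^ q)                 ≤⟨ m≤m+n _ (q ^ q) ⟩
  2 * (q * q ^ q) + q ^ q         ≡⟨ lemma q (q ^ q) ⟩
  q ^ suc q + suc q * q ^ q       ≤⟨ bernoulli q q ⟩
  suc q ^ suc q                   ∎
  where
  open ≤-Reasoning
  lemma : ∀ q a → 2 * (q * a) + a ≡ q * a + (1 + q) * a
  lemma = solve-∀

^-distrib-* : ∀ a b w → (a * b) ^ w ≡ a ^ w * b ^ w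
^-distrib-* a b zero = refl
^-distrib-* a b (suc w) = trans (cong (a * b *_) (^-distrib-* a b w)) ([m*n]*[o*p]≡[m*o]*[n*p] a b (a ^ w) (b ^ w))

-- The exponent consists of `w` blocks of `suc q` factors. By `doubling` each block gains a factor
-- 2, and `2 ^ w` exceeds `2 ^ N`.
choices-beat-colourings : ∀ q N w → N < w → 2 ^ N * q ^ (suc q * w) < suc q ^ (suc q * w)
-- For `q = 0` the strict step below would multiply by zero, but here the left side itself vanishes,
-- as the exponent is positive.
choices-beat-colourings zero N (suc w) N<w rewrite *-zeroʳ (2 ^ N) = m^n>0 1 (1 * suc w)
choices-beat-colourings q@(suc _) N w N<w = begin-strict
  2 ^ N * q ^ (suc q * w)      <⟨ *-monoˡ-< (q ^ (suc q * w)) ⦃ m^n≢0 q (suc q * w) ⦄ (^-monoʳ-< 2 (s≤s (s≤s z≤n)) N<w) ⟩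
  2 ^ w * q ^ (suc q * w)      ≡⟨ cong (2 ^ w *_) (^-*-assoc q (suc q) w) ⟨
  2 ^ w * (q ^ suc q) ^ w      ≡⟨ ^-distrib-* 2 (q ^ suc q) w ⟨
  (2 * q ^ suc q) ^ w          ≤⟨ ^-monoˡ-≤ w (doubling q) ⟩
  (suc q ^ suc q) ^ w          ≡⟨ ^-*-assoc (suc q) (suc q) w ⟩
  suc q ^ (suc q * w)          ∎
  where open ≤-Reasoning

-- Transversals of the columns of a grid

-- The graph of `f` over the columns in `s`. Column `x` is the `x`-th block of length `M`, which
-- matches the numbering of points by `combine`.
transversal : ∀ {r M} → (Fin r → Fin M) → Subset r → Subset (r * M)
transversal f [] = []
transversal f (b ∷ s) = (if b then ⁅ f zero ⁆ else ⊥) ++ transversal (f ∘ suc) s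

∣transversal∣ : ∀ {r M} (f : Fin r → Fin M) s → ∣ transversal f s ∣ ≡ ∣ s ∣
∣transversal∣ f [] = refl
∣transversal∣ f (true ∷ s) = trans (∣++∣ ⁅ f zero ⁆ _) (cong₂ _+_ (∣⁅x⁆∣≡1 (f zero)) (∣transversal∣ (f ∘ suc) s))
∣transversal∣ {M = M} f (false ∷ s) = trans (∣++∣ {M} ⊥ _) (cong₂ _+_ (∣⊥∣≡0 M) (∣transversal∣ (f ∘ suc) s))

∈-transversal⁻ : ∀ {r M} (f : Fin r → Fin M) s {v} → v ∈ₛ transversal f s →
  ∃ λ x → x ∈ₛ s × v ≡ combine x (f x)
∈-transversal⁻ {suc r} {M} f (true ∷ s) v∈ with ∈-++⁻ ⁅ f zero ⁆ v∈
... | inj₁ (u , u∈ , refl) = zero , here , cong (_↑ˡ (r * M)) (x∈⁅y⁆⇒x≡y _ u∈)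
... | inj₂ (u , u∈ , refl) with ∈-transversal⁻ (f ∘ suc) s u∈
... | x , x∈s , refl = suc x , there x∈s , refl
∈-transversal⁻ {suc r} {M} f (false ∷ s) v∈ with ∈-++⁻ {M} ⊥ v∈
... | inj₁ (u , u∈ , refl) = contradiction u∈ ∉⊥
... | inj₂ (u , u∈ , refl) with ∈-transversal⁻ (f ∘ suc) s u∈
... | x , x∈s , refl = suc x , there x∈s , refl

-- A common point lies in a column where `f` and `g` agree and is determined by that column.
∣transversal-∩∣≤1 : ∀ {r M} (f g : Fin r → Fin M) s t →
  (∀ x y → f x ≡ g x → f y ≡ g y → x ≡ y) → ∣ transversal f s ∩ transversal g t ∣ ≤ 1
∣transversal-∩∣≤1 f g s t agree = subsingleton⇒∣p∣≤1 _ λ u v u∈ v∈ →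
  unique (meet u∈) (meet v∈)
  where
  meet : ∀ {v} → v ∈ₛ transversal f s ∩ transversal g t → ∃ λ x → f x ≡ g x × v ≡ combine x (f x)
  meet v∈ with x∈p∩q⁻ _ _ v∈
  ... | v∈f , v∈g with ∈-transversal⁻ f s v∈f | ∈-transversal⁻ g t v∈g
  ... | x , _ , v≡x | y , _ , v≡y with combine-injective x (f x) y (g y) (trans (sym v≡x) v≡y)
  ... | refl , fx≡gx = x , fx≡gx , v≡x
  unique : ∀ {u v} → (∃ λ x → f x ≡ g x × u ≡ combine x (f x)) →
    (∃ λ x → f x ≡ g x × v ≡ combine x (f x)) → u ≡ v
  unique (x , ex , refl) (y , ey , refl) with agree x y ex ey
  ... | refl = refl

-- Lines y = a x + b

module Lines (r L : ℕ) where

  height : Fin L → Fin L → Fin r → ℕ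
  height a b x = toℕ a * toℕ x + toℕ b

  -- Slopes and intercepts are below `L`, so the lines fit over the natural numbers, without modular
  -- arithmetic, into a number of rows linear in `L`.
  height-bound : ∀ a b x → height a b x < r * L
  height-bound a b x = begin-strict
    toℕ a * toℕ x + toℕ b   <⟨ +-mono-≤-< (*-monoˡ-≤ (toℕ x) (<⇒≤ (toℕ<n a))) (toℕ<n b) ⟩
    L * toℕ x + L           ≡⟨ lemma L (toℕ x) ⟩
    suc (toℕ x) * L         ≤⟨ *-monoˡ-≤ L (toℕ<n x) ⟩
    r * L                   ∎
    where
    open ≤-Reasoning
    lemma : ∀ l x → l * x + l ≡ (1 + x) * l
    lemma = solve-∀

  line : Fin (L * L) → Fin r → Fin (r * L)
  line i x = fromℕ< (height-bound (quotient L i) (remainder {L} L i) x)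

  -- With `y = x + 1 + d`, the difference of the two equations is `a * (1 + d) = a′ * (1 + d)`. The
  -- order of `x` and `y` keeps this subtraction within ℕ.
  affine-unique-< : ∀ {a b a′ b′ x y} → x < y →
    a * x + b ≡ a′ * x + b′ → a * y + b ≡ a′ * y + b′ → a ≡ a′ × b ≡ b′
  affine-unique-< {a} {b} {a′} {b′} {x} x<y ex ey with m≤n⇒∃[o]m+o≡n x<y
  ... | d , refl = a≡a′ , +-cancelˡ-≡ (a * x) b b′ (trans ex (cong (λ c → c * x + b′) (sym a≡a′)))
    where
    lemma : ∀ a b x d → a * (1 + (x + d)) + b ≡ (a * x + b) + a * (1 + d)
    lemma = solve-∀
    a≡a′ : a ≡ a′
    a≡a′ = *-cancelʳ-≡ a a′ (suc d) (+-cancelˡ-≡ (a * x + b) _ _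
      (trans (sym (lemma a b x d)) (trans ey (trans (lemma a′ b′ x d) (cong (_+ a′ * suc d) (sym ex))))))

  line-unique : ∀ i j → i ≢ j → ∀ x y → line i x ≡ line j x → line i y ≡ line j y → x ≡ y
  line-unique i j i≢j x y ex ey = decide (<-cmp (toℕ x) (toℕ y))
    where
    a = quotient L i
    b = remainder {L} L i
    a′ = quotient L j
    b′ = remainder {L} L j
    heights : ∀ z → line i z ≡ line j z → height a b z ≡ height a′ b′ z
    heights z e = trans (sym (toℕ-fromℕ< (height-bound a b z))) (trans (cong toℕ e) (toℕ-fromℕ< (height-bound a′ b′ z)))
    i≡j : toℕ a ≡ toℕ a′ × toℕ b ≡ toℕ b′ → i ≡ j
    i≡j (ea , eb) = trans (sym (combine-remQuot {L} L i))
      (trans (cong₂ combine (toℕ-injective ea) (toℕ-injective eb)) (combine-remQuot {L} L j))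
    decide : _ → x ≡ y
    decide (tri< x<y _ _) = contradiction (i≡j (affine-unique-< x<y (heights x ex) (heights y ey))) i≢j
    decide (tri≈ _ x≡y _) = toℕ-injective x≡y
    decide (tri> _ _ y<x) = contradiction (i≡j (affine-unique-< y<x (heights y ey) (heights x ex))) i≢j

-- Linear hypergraphs of chromatic number three

-- Separate quotas `a` and `b` for the two colours make the induction work: each point lowers the
-- quota of its own colour, and a quota of zero is met by the empty set.
constant-class : ∀ r (d : Fin r → Fin 2) a b → a + b ≤ r →
  (∃ λ s → ∣ s ∣ ≡ a × (∀ u → u ∈ₛ s → d u ≡ zero)) ⊎
  (∃ λ s → ∣ s ∣ ≡ b × (∀ u → u ∈ₛ s → d u ≡ suc zero))
constant-class r d zero b _ = inj₁ (⊥ , ∣⊥∣≡0 r , λ _ u∈⊥ → contradiction u∈⊥ ∉⊥)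
constant-class r d (suc a) zero _ = inj₂ (⊥ , ∣⊥∣≡0 r , λ _ u∈⊥ → contradiction u∈⊥ ∉⊥)
constant-class (suc r) d (suc a) (suc b) (s≤s a+b≤r) with d zero in d0
... | zero with constant-class r (d ∘ suc) a (suc b) a+b≤r
...   | inj₁ (s , ∣s∣ , cs) = inj₁ (true ∷ s , cong suc ∣s∣ , λ { zero here → d0 ; (suc u) (there u∈) → cs u u∈ })
...   | inj₂ (s , ∣s∣ , cs) = inj₂ (false ∷ s , ∣s∣ , λ { (suc u) (there u∈) → cs u u∈ })
constant-class (suc r) d (suc a) (suc b) (s≤s a+b≤r) | suc zero
  with constant-class r (d ∘ suc) (suc a) b (subst (_≤ r) (+-suc a b) a+b≤r)
...   | inj₁ (s , ∣s∣ , cs) = inj₁ (false ∷ s , ∣s∣ , λ { (suc u) (there u∈) → cs u u∈ })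
...   | inj₂ (s , ∣s∣ , cs) = inj₂ (true ∷ s , cong suc ∣s∣ , λ { zero here → d0 ; (suc u) (there u∈) → cs u u∈ })

constant-subset : ∀ m (d : Fin (m + m) → Fin 2) → ∃ λ s → ∣ s ∣ ≡ m × ConstantOn d s
constant-subset m d with constant-class (m + m) d m m ≤-refl
... | inj₁ (s , ∣s∣ , cs) = s , ∣s∣ , λ u v u∈ v∈ → trans (cs u u∈) (sym (cs v v∈))
... | inj₂ (s , ∣s∣ , cs) = s , ∣s∣ , λ u v u∈ v∈ → trans (cs u u∈) (sym (cs v v∈))

-- Indexed edges can be chosen one per line and later dropped one by one; repeated values give a
-- single edge.
family : ∀ {K N} → (Fin K → Subset N) → Hypergraph
family {N = N} e = record { order = N ; E = λ s → ∃ λ i → s ≡ e i }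

Linear : Hypergraph → Set
Linear G = ∀ s t → E s → E t → s ≢ t → ∣ s ∩ t ∣ ≤ 1
  where open Hypergraph G

¬2-colourable-linear : ∀ m → ∃ λ N → ∃ λ K → ∃ λ (e : Fin K → Subset N) →
  Uniform (family e) m × Linear (family e) × ¬ Colorable (family e) 2
¬2-colourable-linear m = N , L * L , edge ,
  (λ { _ (i , refl) → trans (∣transversal∣ (line i) (choice (σ i))) (proj₁ (proj₂ (chosen (σ i)))) }) ,
  (λ { _ _ (i , refl) (j , refl) i≢j → ∣transversal-∩∣≤1 (line i) (line j)
    (choice (σ i)) (choice (σ j)) (line-unique i j (i≢j ∘ cong edge)) }) ,
  λ { (c , proper) → let i , mono = covered (funToFin c) in proper (edge i) (i , refl)
      (constantOn-cong (finToFun-funToFin c) mono) }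
  where
  -- Among `m + m` abscissas some `m` share a colour.
  r = m + m
  -- The options on a line are indexed by the `2 ^ r` colour patterns along it rather than by
  -- `m`-sets; `choice` sends a pattern to an `m`-set on which it is constant.
  q = 2 ^ r ∸ 1
  D≡ : suc q ≡ 2 ^ r
  D≡ = m+[n∸m]≡n (m^n>0 2 r)
  -- Since `v` exceeds `r * r`, the number `N` of points is below `v * L`. As `L` is `suc q * v`,
  -- the `L * L` lines form `v * L` blocks of `suc q`, as the counting estimate requires.
  v = 1 + r * r
  L = suc q * v
  N = r * (r * L)
  open Lines r L
  colouring : Fin (suc q) → Fin r → Fin 2
  colouring d = finToFun (subst Fin D≡ d)
  chosen : ∀ d → ∃ λ s → ∣ s ∣ ≡ m × ConstantOn (colouring d) s
  chosen d = constant-subset m (colouring d)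
  choice : Fin (suc q) → Subset r
  choice d = proj₁ (chosen d)
  R : Fin (L * L) → Fin (suc q) → Fin (2 ^ N) → Set
  R i d c = ConstantOn (finToFun c) (transversal (line i) (choice d))
  total : ∀ i c → ∃ λ d → R i d c
  -- The suitable option is the pattern that the colouring `c` itself shows along line `i`.
  total i c = d , constant
    where
    onLine : Fin r → Fin 2
    onLine x = finToFun c (combine x (line i x))
    d : Fin (suc q)
    d = subst Fin (sym D≡) (funToFin onLine)
    restricts : ∀ x → colouring d x ≡ onLine x
    restricts x = trans (cong (λ j → finToFun j x) (subst-subst-sym D≡)) (finToFun-funToFin onLine x)
    constant : R i d c
    constant u v u∈ v∈ with ∈-transversal⁻ (line i) _ u∈ | ∈-transversal⁻ (line i) _ v∈
    ... | x , x∈ , refl | y , y∈ , refl = constantOn-cong restricts (proj₂ (proj₂ (chosen d))) x y x∈ y∈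
  N<vL : N < v * L
  N<vL = begin-strict
    r * (r * L)       ≡⟨ *-assoc r r L ⟨
    r * r * L         <⟨ m<n+m (r * r * L) (s≤s z≤n) ⟩
    L + r * r * L     ∎
    where open ≤-Reasoning
  small : length (allFin (2 ^ N)) * q ^ (L * L) < suc q ^ (L * L)
  small = subst₂ (λ ℓ κ → ℓ * q ^ κ < suc q ^ κ) (sym (length-tabulate {n = 2 ^ N} (λ i → i)))
    (sym (*-assoc (suc q) v L)) (choices-beat-colourings q N (v * L) N<vL)
  cover = greedy-cover q (L * L) R (λ i d c → constantOn? (finToFun c) _) total (allFin (2 ^ N)) small
  σ = proj₁ cover
  covered : ∀ c → ∃ λ i → R i (σ i) c
  covered c = proj₂ cover (∈-allFin c)
  edge : Fin (L * L) → Subset N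
  edge i = transversal (line i) (choice (σ i))

-- There are finitely many colourings to try; deciding this is what makes the search for a critical
-- subfamily effective.
two-colourable? : ∀ {N K} (e : Fin K → Subset N) → Dec (Colorable (family e) 2)
two-colourable? {N} e with Fin.any? (λ (c : Fin (2 ^ N)) → Fin.all? (λ i → ¬? (constantOn? (finToFun c) (e i))))
... | yes (c , proper) = yes (finToFun c , λ { _ (i , refl) → proper i })
... | no none = no λ { (c , proper) → none (funToFin c , λ i → proper (e i) (i , refl) ∘ constantOn-cong (finToFun-funToFin c)) }

recolour : ∀ {N} → (Fin N → Fin 2) → Fin N → Fin N → Fin 3
recolour c v u with u Fin.≟ v
... | yes _ = suc (suc zero)
... | no _ = inject₁ (c u)

recolour-at : ∀ {N} (c : Fin N → Fin 2) v → recolour c v v ≡ suc (suc zero)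
recolour-at c v with v Fin.≟ v
... | yes _ = refl
... | no v≢v = contradiction refl v≢v

recolour-off : ∀ {N} (c : Fin N → Fin 2) {v u} → u ≢ v → recolour c v u ≡ inject₁ (c u)
recolour-off c {v} {u} u≢v with u Fin.≟ v
... | yes u≡v = contradiction u≡v u≢v
... | no _ = refl

inject₁≢2 : (i : Fin 2) → suc (suc zero) ≢ inject₁ i
inject₁≢2 zero ()
inject₁≢2 (suc zero) ()

-- If `s` contained `v`, its second point would carry an old colour, distinct from the third one.
-- Away from `v` the recolouring is `c` up to an injection.
recolour-constant : ∀ {N} (c : Fin N → Fin 2) v s → 2 ≤ ∣ s ∣ → ConstantOn (recolour c v) s → v ∉ₛ s × ConstantOn c s
recolour-constant c v s 2≤∣s∣ con = v∉s , λ u w u∈ w∈ → inject₁-injective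
  (trans (sym (recolour-off c (avoids u∈))) (trans (con u w u∈ w∈) (recolour-off c (avoids w∈))))
  where
  v∉s : v ∉ₛ s
  v∉s v∈s with other-member s 2≤∣s∣ v
  ... | w , w∈s , w≢v = inject₁≢2 (c w) (trans (sym (recolour-at c v)) (trans (con v w v∈s w∈s) (recolour-off c w≢v)))
  avoids : ∀ {u} → u ∈ₛ s → u ≢ v
  avoids u∈s refl = v∉s u∈s

-- Drop edges until the next removal would leave a 2-colourable family; a
-- third colour on one vertex of that edge then suffices.
critical-subfamily : ∀ {N} K (e : Fin K → Subset N) → (∀ i → 2 ≤ ∣ e i ∣) → ¬ Colorable (family e) 2 →
  ∃ λ K′ → ∃ λ (ι : Fin K′ → Fin K) → Colorable (family (e ∘ ι)) 3 × ¬ Colorable (family (e ∘ ι)) 2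
-- Without edges any map is proper, so the removal of edges must stop earlier.
critical-subfamily zero e 2≤ ¬col = contradiction (const zero , λ { _ (() , _) }) ¬col
critical-subfamily (suc K) e 2≤ ¬col with two-colourable? (e ∘ suc)
... | no ¬col′ = let K′ , ι , rest = critical-subfamily K (e ∘ suc) (2≤ ∘ suc) ¬col′ in K′ , suc ∘ ι , rest
... | yes (c , proper) = suc K , (λ i → i) , (recolour c v , proper₃) , ¬col
  where
  vertex = positive⇒nonempty (e zero) (<⇒≤ (2≤ zero))
  v = proj₁ vertex
  proper₃ : Proper (family e) (recolour c v)
  proper₃ _ (zero , refl) con = proj₁ (recolour-constant c v (e zero) (2≤ zero) con) (proj₂ vertex)
  proper₃ _ (suc i , refl) con = proper (e (suc i)) (i , refl) (proj₂ (recolour-constant c v (e (suc i)) (2≤ (suc i)) con))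

3-chromatic-linear : ∀ m → 2 ≤ m →
  ∃ λ G → Uniform G m × Linear G × Satisfiable (Hypergraph.E G) × Colorable G 3 × ¬ Colorable G 2
3-chromatic-linear m 2≤m =
  let N , K , e , uniform , linear , ¬col₂ = ¬2-colourable-linear m
      K′ , ι , col₃ , ¬col₂′ = critical-subfamily K e (λ i → subst (2 ≤_) (sym (uniform (e i) (i , refl))) 2≤m) ¬col₂
  in family (e ∘ ι) ,
     (λ { s (i , eq) → uniform s (ι i , eq) }) ,
     (λ { s t (i , eq) (j , eq′) → linear s t (ι i , eq) (ι j , eq′) }) ,
     nonempty (e ∘ ι) ¬col₂′ , col₃ , ¬col₂′
  where
  -- An edge exists because an empty family is 2-colourable; the extension needs one to realise the
  -- size `n - 1`.
  nonempty : ∀ {N K} (e : Fin K → Subset N) → ¬ Colorable (family e) 2 → Satisfiable (Hypergraph.E (family e))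
  nonempty {K = zero} e ¬col = contradiction (const zero , λ { _ (() , _) }) ¬col
  nonempty {K = suc _} e _ = e zero , zero , refl

-- The cross-intersecting family built from a linear hypergraph

module Extension (k : ℕ) (G : Hypergraph) (uniform : Uniform G (2 + k)) (linear : Linear G) (nonempty : Satisfiable (Hypergraph.E G))
  (col₃ : Colorable G 3) (¬col₂ : ¬ Colorable G 2) where

  open Hypergraph G renaming (order to N; E to S)

  -- The vertices come in three blocks: those of `G`, the `n′` points of `X`, and `1 + k` points
  -- that fill `extra` up from 2 to `n′`.
  n′ order′ : ℕ
  n′ = 3 + k
  order′ = N + (n′ + (1 + k))

  extend : Subset N → Fin n′ → Subset order′
  extend s x = s ++ (⁅ x ⁆ ++ ⊥)

  pair : Subset n′
  pair = inside ∷ inside ∷ ⊥ {1 + k}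
  -- extra realises the sizes 0 and 2 whatever G is.
  X extra : Subset order′
  X = ⊥ {N} ++ (⊤ {n′} ++ ⊥ {1 + k})
  extra = ⊥ {N} ++ (pair ++ ⊤ {1 + k})

  -- Edges within `A` may be disjoint, so `extra` is placed there: it has to meet `X` but not the
  -- edges `extend s x`.
  A B : Pred (Subset order′) 0ℓ
  A e = (∃ λ s → ∃ λ x → S s × e ≡ extend s x) ⊎ (e ≡ extra)
  B e = e ≡ X

  size : (p : Subset N) (q : Subset n′) (t : Subset (1 + k)) → ∣ p ++ (q ++ t) ∣ ≡ ∣ p ∣ + (∣ q ∣ + ∣ t ∣)
  size p q t = trans (∣++∣ p (q ++ t)) (cong (∣ p ∣ +_) (∣++∣ q t))

  ∩-size : (p p′ : Subset N) (q q′ : Subset n′) {t t′ : Subset (1 + k)} →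
    ∣ (p ++ (q ++ t)) ∩ (p′ ++ (q′ ++ t′)) ∣ ≡ ∣ p ∩ p′ ∣ + (∣ q ∩ q′ ∣ + ∣ t ∩ t′ ∣)
  ∩-size p p′ q q′ = trans (∣++-∩-++∣ p p′) (cong (∣ p ∩ p′ ∣ +_) (∣++-∩-++∣ q q′))

  ∣⊥∩∣ : ∀ {m} (p : Subset m) → ∣ ⊥ ∩ p ∣ ≡ 0
  ∣⊥∩∣ {m} p = trans (cong ∣_∣ (∩-zeroˡ p)) (∣⊥∣≡0 m)

  ∣∩⊥∣ : ∀ {m} (p : Subset m) → ∣ p ∩ ⊥ ∣ ≡ 0
  ∣∩⊥∣ {m} p = trans (cong ∣_∣ (∩-zeroʳ p)) (∣⊥∣≡0 m)

  x≢y⇒∣⁅x⁆∩⁅y⁆∣≡0 : ∀ {m} {x y : Fin m} → x ≢ y → ∣ ⁅ x ⁆ ∩ ⁅ y ⁆ ∣ ≡ 0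
  x≢y⇒∣⁅x⁆∩⁅y⁆∣≡0 {m} {x} {y} x≢y = trans (cong ∣_∣ (Empty-unique λ { (z , z∈) →
    let z∈x , z∈y = x∈p∩q⁻ ⁅ x ⁆ ⁅ y ⁆ z∈ in x≢y (trans (sym (x∈⁅y⁆⇒x≡y x z∈x)) (x∈⁅y⁆⇒x≡y y z∈y)) })) (∣⊥∣≡0 m)

  ∣pair∣ : ∣ pair ∣ ≡ 2
  ∣pair∣ = cong (2 +_) (∣⊥∣≡0 (1 + k))

  extend∩extend : ∀ s t x y → ∣ extend s x ∩ extend t y ∣ ≡ ∣ s ∩ t ∣ + ∣ ⁅ x ⁆ ∩ ⁅ y ⁆ ∣
  extend∩extend s t x y = trans (∩-size s t ⁅ x ⁆ ⁅ y ⁆)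
    (cong (∣ s ∩ t ∣ +_) (trans (cong (∣ ⁅ x ⁆ ∩ ⁅ y ⁆ ∣ +_) (∣⊥∩∣ (⊥ {1 + k}))) (+-identityʳ _)))

  extend∩X : ∀ s x → ∣ extend s x ∩ X ∣ ≡ 1
  extend∩X s x = trans (∩-size s ⊥ ⁅ x ⁆ ⊤) (cong₂ _+_ (∣∩⊥∣ s)
    (cong₂ _+_ (trans (cong ∣_∣ (∩-identityʳ ⁅ x ⁆)) (∣⁅x⁆∣≡1 x)) (∣⊥∩∣ (⊥ {1 + k}))))

  extra∩X : ∣ extra ∩ X ∣ ≡ 2
  extra∩X = trans (∩-size ⊥ ⊥ pair ⊤) (cong₂ _+_ (∣⊥∩∣ (⊥ {N}))
    (cong₂ _+_ (trans (cong ∣_∣ (∩-identityʳ pair)) ∣pair∣) (∣∩⊥∣ (⊤ {1 + k}))))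

  extend∩extra : ∀ s x → ∣ extend s x ∩ extra ∣ ≡ ∣ ⁅ x ⁆ ∩ pair ∣
  extend∩extra s x = trans (∩-size s ⊥ ⁅ x ⁆ pair) (cong₂ _+_ (∣∩⊥∣ s)
    (trans (cong (∣ ⁅ x ⁆ ∩ pair ∣ +_) (∣⊥∩∣ (⊤ {1 + k}))) (+-identityʳ _)))

  F : CrossIntersectingFamily
  F = record
    { order = order′
    ; A = A
    ; B = B
    ; A-nonempty = extra , inj₂ refl
    ; B-nonempty = X , refl
    ; cross = λ
      { _ _ (inj₁ (s , x , _ , refl)) refl → positive⇒nonempty _ (≤-reflexive (sym (extend∩X s x)))
      ; _ _ (inj₂ refl) refl → positive⇒nonempty _ (subst (1 ≤_) (sym extra∩X) (s≤s z≤n))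
      }
    }

  H : Hypergraph
  H = CrossIntersectingFamily.hypergraph F

  H-uniform : Uniform H n′
  H-uniform _ (inj₁ (inj₁ (s , x , s∈ , refl))) = trans (size s ⁅ x ⁆ ⊥)
    (trans (cong₂ _+_ (uniform s s∈) (cong₂ _+_ (∣⁅x⁆∣≡1 x) (∣⊥∣≡0 (1 + k)))) (+-comm (2 + k) 1))
  H-uniform _ (inj₁ (inj₂ refl)) = trans (size ⊥ pair ⊤)
    (cong₂ _+_ (∣⊥∣≡0 N) (cong₂ _+_ ∣pair∣ (∣⊤∣≡n (1 + k))))
  H-uniform _ (inj₂ refl) = trans (size ⊥ ⊤ ⊥)
    (trans (cong₂ _+_ (∣⊥∣≡0 N) (cong₂ _+_ (∣⊤∣≡n n′) (∣⊥∣≡0 (1 + k)))) (+-identityʳ n′))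

  -- Intersection sizes

  Sizes : Pred ℕ 0ℓ
  Sizes = ｛ 0 ｝ ∪ ｛ 1 ｝ ∪ ｛ 2 ｝ ∪ ｛ n′ ∸ 1 ｝

  ≤2⇒Sizes : ∀ {j} → j ≤ 2 → Sizes j
  ≤2⇒Sizes z≤n = inj₁ refl
  ≤2⇒Sizes (s≤s z≤n) = inj₂ (inj₁ refl)
  ≤2⇒Sizes (s≤s (s≤s z≤n)) = inj₂ (inj₂ (inj₁ refl))

  ∣⁅x⁆∩p∣≤1 : ∀ {m} (x : Fin m) p → ∣ ⁅ x ⁆ ∩ p ∣ ≤ 1
  ∣⁅x⁆∩p∣≤1 x p = subst (∣ ⁅ x ⁆ ∩ p ∣ ≤_) (∣⁅x⁆∣≡1 x) (∣p∩q∣≤∣p∣ ⁅ x ⁆ p)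

  -- For `s ≢ t`, linearity gives at most one old common point, and there is at most one new one.
  -- For equal `s` and `t` the points `x` and `y` differ, which leaves exactly the `2 + k` points of
  -- `s`.
  extend-sizes : ∀ s t x y → S s → S t → extend s x ≢ extend t y → Sizes ∣ extend s x ∩ extend t y ∣
  extend-sizes s t x y s∈ t∈ ne rewrite extend∩extend s t x y with ≡-dec Bool._≟_ s t
  ... | no s≢t = ≤2⇒Sizes (+-mono-≤ (linear s t s∈ t∈ s≢t) (∣⁅x⁆∩p∣≤1 x ⁅ y ⁆))
  ... | yes refl = inj₂ (inj₂ (inj₂ (sym (trans
    (cong₂ _+_ (trans (cong ∣_∣ (∩-idem s)) (uniform s s∈)) (x≢y⇒∣⁅x⁆∩⁅y⁆∣≡0 (ne ∘ cong (extend s))))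
    (+-identityʳ (2 + k))))))

  extend∩X-sizes : ∀ s x → Sizes ∣ extend s x ∩ X ∣
  extend∩X-sizes s x = inj₂ (inj₁ (sym (extend∩X s x)))

  extra∩X-sizes : Sizes ∣ extra ∩ X ∣
  extra∩X-sizes = inj₂ (inj₂ (inj₁ (sym extra∩X)))

  extend∩extra-sizes : ∀ s x → Sizes ∣ extend s x ∩ extra ∣
  extend∩extra-sizes s x = ≤2⇒Sizes (subst (_≤ 2) (sym (extend∩extra s x)) (m≤n⇒m≤1+n (∣⁅x⁆∩p∣≤1 x pair)))

  swap : (e e′ : Subset order′) → Sizes ∣ e ∩ e′ ∣ → Sizes ∣ e′ ∩ e ∣
  swap e e′ = subst (Sizes ∘ ∣_∣) (∩-comm e e′)

  sizes : ∀ e e′ → (A ∪ B) e → (A ∪ B) e′ → e ≢ e′ → Sizes ∣ e ∩ e′ ∣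
  sizes _ _ (inj₁ (inj₁ (s , x , s∈ , refl))) (inj₁ (inj₁ (t , y , t∈ , refl))) ne = extend-sizes s t x y s∈ t∈ ne
  sizes _ _ (inj₁ (inj₁ (s , x , _ , refl))) (inj₁ (inj₂ refl)) _ = extend∩extra-sizes s x
  sizes _ _ (inj₁ (inj₁ (s , x , _ , refl))) (inj₂ refl) _ = extend∩X-sizes s x
  sizes _ _ (inj₁ (inj₂ refl)) (inj₁ (inj₁ (s , x , _ , refl))) _ = swap (extend s x) extra (extend∩extra-sizes s x)
  sizes _ _ (inj₁ (inj₂ refl)) (inj₁ (inj₂ refl)) ne = contradiction refl ne
  sizes _ _ (inj₁ (inj₂ refl)) (inj₂ refl) _ = extra∩X-sizes
  sizes _ _ (inj₂ refl) (inj₁ (inj₁ (s , x , _ , refl))) _ = swap (extend s x) X (extend∩X-sizes s x)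
  sizes _ _ (inj₂ refl) (inj₁ (inj₂ refl)) _ = swap extra X extra∩X-sizes
  sizes _ _ (inj₂ refl) (inj₂ refl) ne = contradiction refl ne

  Q⊆Sizes : Q H ⊆ Sizes
  Q⊆Sizes (e , e′ , e∈ , e′∈ , e≢e′ , refl) = sizes e e′ e∈ e′∈ e≢e′

  -- Distinctness comes from a size: a set of n′ points meets itself in n′ > j.
  attained : ∀ e e′ → (A ∪ B) e → (A ∪ B) e′ → ∀ {j} → j < n′ → ∣ e ∩ e′ ∣ ≡ j → Q H j
  attained e e′ e∈ e′∈ j<n′ eq = e , e′ , e∈ , e′∈ , e≢e′ , eq
    where
    e≢e′ : e ≢ e′
    e≢e′ refl = <-irrefl (trans (sym eq) (trans (cong ∣_∣ (∩-idem e)) (H-uniform e e∈))) j<n′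

  Sizes⊆Q : Sizes ⊆ Q H
  Sizes⊆Q = λ
    { (inj₁ refl) → attained _ _ (extend∈ x₂) (inj₁ (inj₂ refl)) (s≤s z≤n)
        -- The first three coordinates of `⁅ x₂ ⁆ ∩ pair` compute to `false`; only empty sets on `k`
        -- points remain.
        (trans (extend∩extra s x₂) (∣⊥∩∣ (⊥ {k}) ))
    ; (inj₂ (inj₁ refl)) → attained _ _ (extend∈ zero) (inj₂ refl) (s≤s (s≤s z≤n)) (extend∩X s zero)
    ; (inj₂ (inj₂ (inj₁ refl))) → attained _ _ (inj₁ (inj₂ refl)) (inj₂ refl) (s≤s (s≤s (s≤s z≤n))) extra∩X
    ; (inj₂ (inj₂ (inj₂ refl))) → attained _ _ (extend∈ zero) (extend∈ x₂) ≤-refl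
        (trans (extend∩extend s s zero x₂) (trans
          (cong₂ _+_ (trans (cong ∣_∣ (∩-idem s)) (uniform s s∈)) (x≢y⇒∣⁅x⁆∩⁅y⁆∣≡0 {x = zero} {y = x₂} λ ()))
          (+-identityʳ (2 + k))))
    }
    where
    s = proj₁ nonempty
    s∈ = proj₂ nonempty
    -- A third point of `X`, outside `pair` and distinct from `zero`; it exists since `n′` is at
    -- least 3.
    x₂ : Fin n′
    x₂ = suc (suc zero)
    extend∈ : ∀ x → (A ∪ B) (extend s x)
    extend∈ x = inj₁ (inj₁ (s , x , s∈ , refl))

  -- Chromatic number of the extended family

  old : Fin N → Fin order′
  old u = u ↑ˡ (n′ + (1 + k))

  new : Fin n′ → Fin order′
  new x = N ↑ʳ (x ↑ˡ (1 + k))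

  -- Old points keep the colours of `G`, which already splits every `extend s x`. Among the others
  -- only `new zero` gets colour `zero`; `X` and `extra` both contain it and `new (suc zero)`.
  H-colourable : Colorable H 3
  H-colourable = c′ , λ
    { _ (inj₁ (inj₁ (s , x , s∈ , refl))) con → proper s s∈ λ u v u∈ v∈ →
        trans (sym (c′-old u)) (trans (con (old u) (old v) (∈-++⁺ˡ u∈) (∈-++⁺ˡ v∈)) (c′-old v))
    ; _ (inj₁ (inj₂ refl)) con → c′-splits (con (new zero) (new (suc zero))
        (∈-++⁺ʳ (⊥ {N}) here) (∈-++⁺ʳ (⊥ {N}) (there here)))
    ; _ (inj₂ refl) con → c′-splits (con (new zero) (new (suc zero))
        (∈-++⁺ʳ (⊥ {N}) here) (∈-++⁺ʳ (⊥ {N}) (there here)))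
    }
    where
    c = proj₁ col₃
    proper = proj₂ col₃
    c-new : Fin (n′ + (1 + k)) → Fin 3
    c-new zero = zero
    c-new (suc _) = suc zero
    c′ : Fin order′ → Fin 3
    c′ = [ c , c-new ]′ ∘ splitAt N
    c′-old : ∀ u → c′ (old u) ≡ c u
    c′-old u = cong [ c , c-new ]′ (splitAt-↑ˡ N u (n′ + (1 + k)))
    c′-new : ∀ x → c′ (new x) ≡ c-new (x ↑ˡ (1 + k))
    c′-new x = cong [ c , c-new ]′ (splitAt-↑ʳ N (n′ + (1 + k)) (x ↑ˡ (1 + k)))
    c′-splits : c′ (new zero) ≢ c′ (new (suc zero))
    c′-splits eq = contradiction (trans (sym (c′-new zero)) (trans eq (c′-new (suc zero)))) λ ()

  only-two : (i j l : Fin 2) → j ≢ i → l ≢ i → j ≡ l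
  only-two zero zero _ j≢i _ = contradiction refl j≢i
  only-two zero (suc zero) zero _ l≢i = contradiction refl l≢i
  only-two zero (suc zero) (suc zero) _ _ = refl
  only-two (suc zero) zero zero _ _ = refl
  only-two (suc zero) zero (suc zero) _ l≢i = contradiction refl l≢i
  only-two (suc zero) (suc zero) _ j≢i _ = contradiction refl j≢i

  -- If some `s` were monochromatic, each point `x` of `X` would need the opposite colour, lest
  -- `extend s x` be monochromatic. With two colours that makes `X` monochromatic.
  H-not-2-colourable : ¬ Colorable H 2
  H-not-2-colourable (c , proper) = ¬col₂ (c ∘ old , λ s s∈ con →
    let u , u∈s = positive⇒nonempty s (subst (1 ≤_) (sym (uniform s s∈)) (s≤s z≤n))
    in proper X (inj₂ refl) λ v w v∈ w∈ → only-two (c (old u)) (c v) (c w)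
         (avoids s s∈ con u∈s v∈) (avoids s s∈ con u∈s w∈))
    where
    avoids : ∀ s → S s → ConstantOn (c ∘ old) s → ∀ {u} → u ∈ₛ s → ∀ {v} → v ∈ₛ X → c v ≢ c (old u)
    avoids s s∈ con {u} u∈s v∈X cv≡cu with ∈-++⁻ (⊥ {N}) v∈X
    ... | inj₁ (_ , v∈⊥ , _) = ∉⊥ v∈⊥
    ... | inj₂ (_ , w∈ , refl) with ∈-++⁻ (⊤ {n′}) w∈
    ... | inj₂ (_ , w∈⊥ , _) = ∉⊥ w∈⊥
    ... | inj₁ (x , _ , refl) = proper (extend s x) (inj₁ (inj₁ (s , x , s∈ , refl)))
      λ v w v∈ w∈ → trans (same v∈) (sym (same w∈))
      where
      same : ∀ {v} → v ∈ₛ extend s x → c v ≡ c (old u)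
      same v∈ with ∈-++⁻ s v∈
      ... | inj₁ (v , v∈s , refl) = con v u v∈s u∈s
      ... | inj₂ (_ , w∈ , refl) with ∈-++⁻ ⁅ x ⁆ w∈
      ... | inj₂ (_ , w∈⊥ , _) = contradiction w∈⊥ ∉⊥
      ... | inj₁ (y , y∈ , refl) = trans (cong (c ∘ new) (x∈⁅y⁆⇒x≡y x y∈)) cv≡cu

  H-chromatic : IsChromaticNumber H 3
  H-chromatic = H-colourable , λ j (c , proper) → ≮⇒≥ λ j<3 →
    let j≤2 = s≤s⁻¹ j<3 in
    -- Fewer than three colours embed into two, and injectivity keeps the colouring proper.
    H-not-2-colourable ((λ v → inject≤ (c v) j≤2) , λ e e∈ con →
      proper e e∈ λ u v u∈ v∈ → inject≤-injective j≤2 j≤2 (c u) (c v) (con u v u∈ v∈))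

theorem1p12 : ∀ (n : ℕ) → 3 ≤ n → ∃ λ (F : CrossIntersectingFamily) →
    let H = CrossIntersectingFamily.hypergraph F in
    Uniform H n × (Q H ≐ (｛ 0 ｝ ∪ ｛ 1 ｝ ∪ ｛ 2 ｝ ∪ ｛ n ∸ 1 ｝)) × IsChromaticNumber H 3
theorem1p12 (suc (suc (suc k))) (s≤s (s≤s (s≤s z≤n))) =
  -- The edges of `G` have `n - 1` points; `3 ≤ n` makes that at least two, as the recolouring
  -- argument requires.
  let G , uniform , linear , nonempty , col₃ , ¬col₂ = 3-chromatic-linear (2 + k) (s≤s (s≤s z≤n))
      open Extension k G uniform linear nonempty col₃ ¬col₂
  in F , H-uniform , (Q⊆Sizes , Sizes⊆Q) , H-chromatic
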